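{- Let $m,n\in\mathbb{Z}$ with $1\leq m<n\leq 2m$. There exists a graph $G$ such that $\mathrm{gon}_1(G)=m$ and $\mathrm{gon}_2(G)=n$.
   Context: All graphs are finite, connected, loopless multigraphs with nonempty vertex set $V(G)$ and multiset of edges $E(G)$. A divisor on $G$ is an element $D=\sum_v D(v)\cdot v$ of the free abelian group on $V(G)$; its degree is $\deg(D)=\sum_v D(v)$; it is effective if $D(v)\ge 0$ for all $v$. The Laplacian matrix has diagonal entries $\mathrm{val}(v)$ (number of edges incident to $v$) and off-diagonal entries $-|E(v,w)|$ (minus the number of edges between $v$ and $w$). Divisors $D,D'$ are linearly equivalent, $D\sim D'$, if $D-D'$ is in the image of $\mathbb{Z}^{V(G)}$ under the Laplacian. The rank $r(D)$ is $-1$ if $D$ is not equivalent to any effective divisor; otherwise it is the largest integer $r\ge 0$ such that for every effective divisor $E$ of degree $r$, $D-E$ is equivalent to an effective divisor. For an integer $r\ge 1$, the $r$-th gonality is $\mathrm{gon}_r(G)=\min\{\deg(D): D \text{ a divisor on } G,\ r(D)\ge r\}$. -}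

module Defs where

open import Data.Nat.Base as ℕ using (ℕ)
open import Data.Integer.Base using (ℤ; +_; -1ℤ; 0ℤ; _-_; -_; _*_; _≤_)
open import Data.Integer.Properties using (+-0-commutativeMonoid)
open import Algebra.Properties.CommutativeMonoid.Sum +-0-commutativeMonoid using (sum)
open import Data.Fin.Base using (Fin)
open import Data.Fin.Properties using (_≟_)
open import Data.Bool.Base using (if_then_else_)
open import Data.Product.Base using (_×_; ∃-syntax; Σ-syntax)
open import Relation.Binary.Construct.Closure.ReflexiveTransitive using (Star)
open import Relation.Binary.PropositionalEquality.Core using (_≡_)
open import Relation.Nullary.Decidable.Core using (does)
open import Relation.Nullary.Negation.Core using (¬_)

-- Finite connected loopless multigraphs.  The multiset of edges is recorded by
-- multiplicities: ∣E∣ v w is the number of edges between v and w.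
record Graph : Set where
  field
    order       : ℕ
    nonempty    : ℕ.NonZero order
    ∣E∣         : Fin order → Fin order → ℕ
    undirected  : ∀ v w → ∣E∣ v w ≡ ∣E∣ w v
    loopless    : ∀ v → ∣E∣ v v ≡ 0

  V : Set
  V = Fin order

  Adjacent : V → V → Set
  Adjacent v w = 0 ℕ.< ∣E∣ v w

  field
    connected   : ∀ v w → Star Adjacent v w

module _ (G : Graph) where
  open Graph G

  val : V → ℤ
  val v = sum (λ w → + ∣E∣ v w)

  laplacian : V → V → ℤ
  laplacian v w = if does (v ≟ w) then val v else - (+ ∣E∣ v w)

  Divisor : Set
  Divisor = V → ℤ

  deg : Divisor → ℤ
  deg D = sum D

  Effective : Divisor → Set
  Effective D = ∀ v → 0ℤ ≤ D v

  infixl 6 _⊖_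
  _⊖_ : Divisor → Divisor → Divisor
  (D ⊖ D′) v = D v - D′ v

  infix 4 _∼_
  _∼_ : Divisor → Divisor → Set
  D ∼ D′ = Σ[ f ∈ (V → ℤ) ] (∀ v → (D ⊖ D′) v ≡ sum (λ w → laplacian v w * f w))

  EquivalentToEffective : Divisor → Set
  EquivalentToEffective D = ∃[ D′ ] Effective D′ × D ∼ D′

  RemainsEffective : Divisor → ℕ → Set
  RemainsEffective D k =
    ∀ (E : Divisor) → Effective E → deg E ≡ + k → EquivalentToEffective (D ⊖ E)

  -- The rank is given as a relation: IsRank D ρ says r(D) = ρ.
  data IsRank (D : Divisor) : ℤ → Set where
    rank-minus-one : ¬ EquivalentToEffective D → IsRank D -1ℤ
    rank-nonneg    : ∀ {r : ℕ} →
                     EquivalentToEffective D →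
                     RemainsEffective D r →
                     (∀ s → RemainsEffective D s → s ℕ.≤ r) →
                     IsRank D (+ r)

  RankAtLeast : ℤ → Divisor → Set
  RankAtLeast r D = ∃[ ρ ] IsRank D ρ × r ≤ ρ

  -- IsGonality r d says gon_r(G) = d; meaningful for r ≥ 1.
  IsGonality : ℤ → ℤ → Set
  IsGonality r d =
    (∃[ D ] RankAtLeast r D × deg D ≡ d) ×
    (∀ (D : Divisor) → RankAtLeast r D → d ≤ deg D)

{-# OPTIONS --safe #-}
-- Take the complete graph K_{a+1} with a = 2m - n + 1 and join k = n - m - 1 pendant
-- vertices to one of its vertices by n parallel edges each.  A divisor of degree less
-- than n cannot move chips along those heavy edges, so rank r forces r chips on every
-- pendant vertex.  On the complete graph, firing a set of c vertices costs at least
-- c (a + 1 - c) ≥ a chips, so an effective divisor with fewer than a chips there is alone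
-- in its class and would need a chip on each of the a + 1 vertices to have rank 1.
-- Hence gon_1 ≥ a + k = m, and removing one further chip gives gon_2 ≥ 1 + a + 2k = n.
-- Both bounds are attained by 1 (resp. 2) chips on each pendant vertex and one on each
-- clique vertex, except for gon_1 on the vertex carrying the pendants: a clique vertex
-- in debt borrows one chip from every other clique vertex.
module Submission where

open import Defs
open import Data.Integer.Base using (ℤ; +_; _*_; _≤_; _<_)
open import Data.Product.Base using (_×_; Σ-syntax)

open import Data.Bool.Base using (if_then_else_)
open import Data.Fin.Base using (Fin; zero; suc; _↑ˡ_; _↑ʳ_; splitAt)
import Data.Fin.Properties as Fin
open import Data.Integer.Base using (0ℤ; 1ℤ; _+_; _-_; -_; +≤+; +<+; -<+; nonNegative)
import Data.Integer.Properties as ℤ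
open import Algebra.Properties.Semiring.Sum ℤ.+-*-semiring
  using (sum; sum-cong-≗; ∑-distrib-+; ∑-comm; *-distribʳ-sum)
open import Data.Integer.Tactic.RingSolver using (solve-∀)
open import Data.Nat.Base as ℕ using (ℕ)
import Data.Nat.Properties as ℕ
open import Data.Nat.Tactic.RingSolver using () renaming (solve-∀ to ℕ-solve-∀)
open import Data.Product.Base using (∃-syntax; _,_; proj₁; proj₂)
open import Data.Sum.Base using (_⊎_; inj₁; inj₂; [_,_]′)
open import Function.Base using (_∘_)
open import Relation.Binary.Construct.Closure.ReflexiveTransitive using (Star; ε; _◅_; _◅◅_)
open import Relation.Binary.PropositionalEquality
  using (_≡_; _≢_; refl; sym; trans; cong; cong₂; subst; subst₂; module ≡-Reasoning)
open import Relation.Nullary.Decidable.Core using (Dec; yes; no; does)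
open import Relation.Nullary.Negation.Core using (contradiction)

-- Integer inequalities and finite sums.

-- Splits an inequality into a ring identity for the difference, left to the solver, and the
-- nonnegativity of its rewritten form.
≤-by : ∀ {i j} d → 0ℤ ≤ d → j - i ≡ d → i ≤ j
≤-by d 0≤d eq = ℤ.0≤i-j⇒j≤i (subst (0ℤ ≤_) (sym eq) 0≤d)

+-cancelˡ-≤ : ∀ k {i j} → k + i ≤ k + j → i ≤ j
+-cancelˡ-≤ k {i} {j} le = ≤-by _ (ℤ.i≤j⇒0≤j-i le) (lemma k i j)
  where
  lemma : ∀ k i j → j - i ≡ k + j - (k + i)
  lemma = solve-∀

nonneg-+ : ∀ {i j} → 0ℤ ≤ i → 0ℤ ≤ j → 0ℤ ≤ i + j
nonneg-+ = ℤ.+-mono-≤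

0≤+ : ∀ n → 0ℤ ≤ + n
0≤+ n = +≤+ ℕ.z≤n

sum-mono : ∀ {n} {f g : Fin n → ℤ} → (∀ i → f i ≤ g i) → sum f ≤ sum g
sum-mono {ℕ.zero}  f≤g = ℤ.≤-refl
sum-mono {ℕ.suc n} f≤g = ℤ.+-mono-≤ (f≤g zero) (sum-mono (f≤g ∘ suc))

sum-const : ∀ n c → sum {n} (λ _ → c) ≡ + n * c
sum-const ℕ.zero    c = refl
sum-const (ℕ.suc n) c = trans (cong (_+_ c) (sum-const n c)) (sym (ℤ.suc-* (+ n) c))

sum-zero : ∀ {n} {f : Fin n → ℤ} → (∀ i → f i ≡ 0ℤ) → sum f ≡ 0ℤ
sum-zero {n} f≡0 = trans (sum-cong-≗ f≡0) (trans (sum-const n 0ℤ) (ℤ.*-zeroʳ (+ n)))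

sum-distrib-- : ∀ {n} (f g : Fin n → ℤ) → sum (λ i → f i - g i) ≡ sum f - sum g
sum-distrib-- {ℕ.zero}  f g = refl
sum-distrib-- {ℕ.suc n} f g =
  trans (cong (_+_ (f zero - g zero)) (sum-distrib-- (f ∘ suc) (g ∘ suc)))
        (lemma (f zero) (g zero) (sum (f ∘ suc)) (sum (g ∘ suc)))
  where
  lemma : ∀ a b c d → a - b + (c - d) ≡ a + c - (b + d)
  lemma = solve-∀

sum-nonneg : ∀ {n} {f : Fin n → ℤ} → (∀ i → 0ℤ ≤ f i) → 0ℤ ≤ sum f
sum-nonneg {ℕ.zero}  0≤f = ℤ.≤-refl
sum-nonneg {ℕ.suc n} 0≤f = nonneg-+ (0≤f zero) (sum-nonneg (0≤f ∘ suc))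

nonneg-* : ∀ {i j} → 0ℤ ≤ i → 0ℤ ≤ j → 0ℤ ≤ i * j
nonneg-* {i} {j} 0≤i 0≤j =
  subst (_≤ i * j) (ℤ.*-zeroʳ i) (ℤ.*-monoˡ-≤-nonNeg i {{nonNegative 0≤i}} 0≤j)

≤+ˡ : ∀ {i j k} → 0ℤ ≤ k → i ≤ j → i ≤ k + j
≤+ˡ {i} {j} {k} 0≤k i≤j = subst (_≤ k + j) (ℤ.+-identityˡ i) (ℤ.+-mono-≤ 0≤k i≤j)

≤+ʳ : ∀ {i k} → 0ℤ ≤ k → i ≤ i + k
≤+ʳ {i} {k} 0≤k = subst (_≤ i + k) (ℤ.+-identityʳ i) (ℤ.+-monoʳ-≤ i 0≤k)

term≤sum : ∀ {n} {f : Fin n → ℤ} → (∀ i → 0ℤ ≤ f i) → ∀ i → f i ≤ sum f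
term≤sum 0≤f zero    = ≤+ʳ (sum-nonneg (0≤f ∘ suc))
term≤sum 0≤f (suc i) = ≤+ˡ (0≤f zero) (term≤sum (0≤f ∘ suc) i)

two-terms≤sum : ∀ {n} {f : Fin n → ℤ} → (∀ i → 0ℤ ≤ f i) →
                ∀ i j → i ≢ j → f i + f j ≤ sum f
two-terms≤sum 0≤f zero zero i≢j = contradiction refl i≢j
two-terms≤sum {f = f} 0≤f zero (suc j) i≢j = ℤ.+-monoʳ-≤ (f zero) (term≤sum (0≤f ∘ suc) j)
two-terms≤sum {f = f} 0≤f (suc i) zero i≢j =
  subst (_≤ _) (ℤ.+-comm (f zero) (f (suc i))) (ℤ.+-monoʳ-≤ (f zero) (term≤sum (0≤f ∘ suc) i))
two-terms≤sum 0≤f (suc i) (suc j) i≢j =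
  ≤+ˡ (0≤f zero) (two-terms≤sum (0≤f ∘ suc) i j (i≢j ∘ cong suc))

sum-split : ∀ m {n} (f : Fin (m ℕ.+ n) → ℤ) →
            sum f ≡ sum (λ i → f (i ↑ˡ n)) + sum (λ j → f (m ↑ʳ j))
sum-split ℕ.zero    f = sym (ℤ.+-identityˡ _)
sum-split (ℕ.suc m) f =
  trans (cong (_+_ (f zero)) (sum-split m (f ∘ suc))) (sym (ℤ.+-assoc (f zero) _ _))

δ : ∀ {n} → Fin n → Fin n → ℤ
δ i j = if does (i Fin.≟ j) then 1ℤ else 0ℤ

δ-refl : ∀ {n} (i : Fin n) → δ i i ≡ 1ℤ
δ-refl zero    = refl
δ-refl (suc i) = δ-refl i

sum-δ : ∀ {n} (i : Fin n) (f : Fin n → ℤ) → sum (λ j → δ i j * f j) ≡ f i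
sum-δ zero    f = trans (cong₂ _+_ (ℤ.*-identityˡ (f zero)) (sum-zero (λ j → ℤ.*-zeroˡ (f (suc j)))))
                        (ℤ.+-identityʳ (f zero))
sum-δ (suc i) f = trans (cong₂ _+_ (ℤ.*-zeroˡ (f zero)) (sum-δ i (f ∘ suc))) (ℤ.+-identityˡ _)

argmax : ∀ {n} (f : Fin (ℕ.suc n) → ℤ) → ∃[ i ] (∀ j → f j ≤ f i)
argmax {ℕ.zero}  f = zero , λ { zero → ℤ.≤-refl }
argmax {ℕ.suc n} f with argmax (f ∘ suc)
... | i , max with ℤ.≤-total (f zero) (f (suc i))
...   | inj₁ f0≤fi = suc i , λ { zero → f0≤fi ; (suc j) → max j }
...   | inj₂ fi≤f0 = zero , λ { zero → ℤ.≤-refl ; (suc j) → ℤ.≤-trans (max j) fi≤f0 }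

-- Chip firing, rank and gonality on an arbitrary graph.

module Firing (G : Graph) where
  open Graph G

  -- The net number of chips leaving `v` when every `w` fires `f w` times. Only differences of `f`
  -- enter, so edges between equal values visibly carry nothing.
  Δ : (V → ℤ) → V → ℤ
  Δ f v = sum (λ w → + ∣E∣ v w * (f v - f w))

  laplacian≡Δ : ∀ f v → sum (λ w → laplacian G v w * f w) ≡ Δ f v
  laplacian≡Δ f v = begin
    sum (λ w → laplacian G v w * f w)
      ≡⟨ sum-cong-≗ entry ⟩
    sum (λ w → δ v w * (val G v * f w) - e w * f w)
      ≡⟨ sum-distrib-- (λ w → δ v w * (val G v * f w)) (λ w → e w * f w) ⟩
    sum (λ w → δ v w * (val G v * f w)) - sum (λ w → e w * f w)
      ≡⟨ cong (_- sum (λ w → e w * f w)) (trans (sum-δ v (λ w → val G v * f w)) (*-distribʳ-sum (f v) e)) ⟩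
    sum (λ w → e w * f v) - sum (λ w → e w * f w)
      ≡⟨ sum-distrib-- (λ w → e w * f v) (λ w → e w * f w) ⟨
    sum (λ w → e w * f v - e w * f w)
      ≡⟨ sum-cong-≗ (λ w → lemma (e w) (f v) (f w)) ⟩
    Δ f v ∎
    where
    open ≡-Reasoning
    e : V → ℤ
    e w = + ∣E∣ v w
    lemma : ∀ a b c → a * b - a * c ≡ a * (b - c)
    lemma = solve-∀
    diag : ∀ a b → a * b ≡ 1ℤ * (a * b) - 0ℤ * b
    diag = solve-∀
    offdiag : ∀ a b c → - a * c ≡ 0ℤ * (b * c) - a * c
    offdiag = solve-∀
    entry : ∀ w → laplacian G v w * f w ≡ δ v w * (val G v * f w) - e w * f w
    entry w with v Fin.≟ w
    -- Looplessness kills the subtracted term here, so diagonal and off-diagonal entries fit one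
    -- formula.
    ... | yes refl rewrite loopless v = diag (val G v) (f v)
    ... | no  _    = offdiag (e w) (val G v) (f w)

  -- Every edge counts once with each sign: exchanging the two sums and using the symmetry of the
  -- multiplicities turns one half into the other.
  sum-Δ : ∀ f → sum (Δ f) ≡ 0ℤ
  sum-Δ f = begin
    sum (Δ f)
      ≡⟨ sum-cong-≗ (λ v → trans (sum-cong-≗ (λ w → lemma (e v w) (f v) (f w)))
                                 (sum-distrib-- (λ w → e v w * f v) (λ w → e v w * f w))) ⟩
    sum (λ v → sum (λ w → e v w * f v) - sum (λ w → e v w * f w))
      ≡⟨ sum-distrib-- (λ v → sum (λ w → e v w * f v)) (λ v → sum (λ w → e v w * f w)) ⟩
    sum (λ v → sum (λ w → e v w * f v)) - sum (λ v → sum (λ w → e v w * f w))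
      ≡⟨ cong (_- s) (∑-comm (λ v w → e v w * f v)) ⟩
    sum (λ w → sum (λ v → e v w * f v)) - s
      ≡⟨ cong (_- s) (sum-cong-≗ (λ w → sum-cong-≗ (λ v → cong (λ n → + n * f v) (undirected v w)))) ⟩
    s - s
      ≡⟨ ℤ.+-inverseʳ s ⟩
    0ℤ ∎
    where
    open ≡-Reasoning
    e : V → V → ℤ
    e v w = + ∣E∣ v w
    s : ℤ
    s = sum (λ v → sum (λ w → e v w * f w))
    lemma : ∀ a b c → a * (b - c) ≡ a * b - a * c
    lemma = solve-∀

  Δ-distrib-- : ∀ f g v → Δ (λ w → f w - g w) v ≡ Δ f v - Δ g v
  Δ-distrib-- f g v =
    trans (sum-cong-≗ (λ w → lemma (+ ∣E∣ v w) (f v) (g v) (f w) (g w)))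
          (sum-distrib-- (λ w → + ∣E∣ v w * (f v - f w)) (λ w → + ∣E∣ v w * (g v - g w)))
    where
    lemma : ∀ e a b c d → e * (a - b - (c - d)) ≡ e * (a - c) - e * (b - d)
    lemma = solve-∀

  infixl 6 _⊝_ _⊕_
  _⊝_ : Divisor G → Divisor G → Divisor G
  _⊝_ = Defs._⊖_ G

  _⊕_ : Divisor G → Divisor G → Divisor G
  (D ⊕ E) v = D v + E v

  ⊕-effective : ∀ {D E} → Effective G D → Effective G E → Effective G (D ⊕ E)
  ⊕-effective 0≤D 0≤E v = nonneg-+ (0≤D v) (0≤E v)

  infixl 7 _·_
  _·_ : ℕ → V → Divisor G
  (r · v) w = δ v w * + r

  ·-effective : ∀ r v → Effective G (r · v)
  ·-effective r v w with v Fin.≟ w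
  ... | yes _ = subst (0ℤ ≤_) (sym (ℤ.*-identityˡ (+ r))) (0≤+ r)
  ... | no  _ = ℤ.≤-refl

  deg-· : ∀ r v → deg G (r · v) ≡ + r
  deg-· r v = sum-δ v (λ _ → + r)

  ·-at : ∀ r v → (r · v) v ≡ + r
  ·-at r v = trans (cong (_* + r) (δ-refl v)) (ℤ.*-identityˡ (+ r))

  infix 4 _∼[_]_
  -- Keeps the firing function visible, since the rigidity arguments compare its values.
  _∼[_]_ : Divisor G → (V → ℤ) → Divisor G → Set
  D ∼[ f ] D′ = ∀ v → D v - D′ v ≡ Δ f v

  ∼[]⇒∼ : ∀ D D′ f → D ∼[ f ] D′ → Defs._∼_ G D D′
  ∼[]⇒∼ D D′ f eq = f , λ v → trans (eq v) (sym (laplacian≡Δ f v))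

  ∼⇒∼[] : ∀ D D′ (s : Defs._∼_ G D D′) → D ∼[ proj₁ s ] D′
  ∼⇒∼[] D D′ (f , eq) v = trans (eq v) (laplacian≡Δ f v)

  deg-∼[] : ∀ D D′ f → D ∼[ f ] D′ → deg G D ≡ deg G D′
  deg-∼[] D D′ f eq = ℤ.i-j≡0⇒i≡j (deg G D) (deg G D′)
    (trans (sym (sum-distrib-- D D′)) (trans (sum-cong-≗ eq) (sum-Δ f)))

  effective⇒equivalentToEffective : ∀ {D} → Effective G D → EquivalentToEffective G D
  effective⇒equivalentToEffective {D} 0≤D = D , 0≤D , ∼[]⇒∼ D D (λ _ → 0ℤ)
    (λ v → trans (ℤ.+-inverseʳ (D v)) (sym (sum-zero (λ w → ℤ.*-zeroʳ (+ ∣E∣ v w)))))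

  -- The same firing function serves; the surplus of `D′` over `D` is added to the effective
  -- representative.
  equivalentToEffective-mono : ∀ D D′ → (∀ v → D v ≤ D′ v) →
                                EquivalentToEffective G D → EquivalentToEffective G D′
  equivalentToEffective-mono D D′ D≤D′ (F , 0≤F , s) =
    F′ ,
    (λ v → nonneg-+ (0≤F v) (ℤ.i≤j⇒0≤j-i (D≤D′ v))) ,
    ∼[]⇒∼ D′ F′ (proj₁ s) (λ v → trans (lemma (D v) (D′ v) (F v)) (∼⇒∼[] D F s v))
    where
    F′ : Divisor G
    F′ v = F v + (D′ v - D v)
    lemma : ∀ a b c → b - (c + (b - a)) ≡ a - c
    lemma = solve-∀

  remainsEffective⇒equivalentToEffective :
    ∀ D r → V → RemainsEffective G D r → EquivalentToEffective G D
  remainsEffective⇒equivalentToEffective D r v re =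
    equivalentToEffective-mono (D ⊝ r · v) D
      (λ w → ≤-by _ (·-effective r v w) (lemma (D w) ((r · v) w)))
      (re (r · v) (·-effective r v) (deg-· r v))
    where
    lemma : ∀ a b → a - (a - b) ≡ b
    lemma = solve-∀

  -- The `j` chips taken from `v` are counted as part of the test divisor, whose degree becomes
  -- `r + j`.
  remainsEffective-⊖ : ∀ D {r} j v → RemainsEffective G D (r ℕ.+ j) →
                       RemainsEffective G (D ⊝ j · v) r
  remainsEffective-⊖ D j v re E 0≤E degE =
    equivalentToEffective-mono _ _
      (λ w → ℤ.≤-reflexive (lemma (D w) (E w) ((j · v) w)))
      (re (E ⊕ (j · v)) (⊕-effective 0≤E (·-effective j v))
        (trans (∑-distrib-+ E (j · v)) (cong₂ _+_ degE (deg-· j v))))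
    where
    lemma : ∀ a b c → a - (b + c) ≡ a - c - b
    lemma = solve-∀

  deg-⊖-· : ∀ D j v → deg G (D ⊝ j · v) ≡ deg G D - + j
  deg-⊖-· D j v = trans (sum-distrib-- D (j · v)) (cong (_-_ (deg G D)) (deg-· j v))

  -- The test divisor is padded to degree `s` with chips on `v`, which monotonicity then gives back.
  remainsEffective-≤ : ∀ D {r s} → V → r ℕ.≤ s → RemainsEffective G D s → RemainsEffective G D r
  remainsEffective-≤ D {r} {s} v r≤s re E 0≤E degE =
    equivalentToEffective-mono (D ⊝ ((s ℕ.∸ r) · v) ⊝ E) (D ⊝ E)
      (λ w → ≤-by _ (·-effective (s ℕ.∸ r) v w) (lemma (D w) (E w) (((s ℕ.∸ r) · v) w)))
      (remainsEffective-⊖ D (s ℕ.∸ r) v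
        (subst (RemainsEffective G D) (sym (ℕ.m+[n∸m]≡n r≤s)) re) E 0≤E degE)
    where
    lemma : ∀ a b c → a - b - (a - c - b) ≡ c
    lemma = solve-∀

  -- Trades exact ranks for `RemainsEffective`. The rank of `W` cannot exceed `r`: otherwise
  -- removing the excess in chips would leave a divisor that violates `lower`.
  isGonality : ∀ {r d} → V → (W : Divisor G) → RemainsEffective G W r → deg G W ≡ d →
               (∀ D → RemainsEffective G D r → d ≤ deg G D) →
               1 ℕ.≤ r → IsGonality G (+ r) d
  isGonality {r} {d} v W re degW lower 1≤r =
    (W , (+ r , rank-nonneg (remainsEffective⇒equivalentToEffective W r v re) re maximal , ℤ.≤-refl) , degW) ,
    λ { D (_ , rank-minus-one _ , ())
      ; D (_ , rank-nonneg _ reD _ , +≤+ r≤ρ) → lower D (remainsEffective-≤ D v r≤ρ reD) }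
    where
    maximal : ∀ s → RemainsEffective G W s → s ℕ.≤ r
    maximal s reW with s ℕ.≤? r
    ... | yes s≤r = s≤r
    ... | no  s≰r with ℕ.m≤n⇒∃[o]m+o≡n (ℕ.≰⇒> s≰r)
    ...   | o , refl = contradiction d≤d-1 (ℤ.<⇒≱ d-1<d)
      where
      d≤d-1 : d ≤ d - + ℕ.suc o
      d≤d-1 = subst (d ≤_) (trans (deg-⊖-· W (ℕ.suc o) v) (cong (_- + ℕ.suc o) degW))
        (lower _ (remainsEffective-⊖ W (ℕ.suc o) v
          (subst (RemainsEffective G W) (sym (ℕ.+-suc r o)) reW)))
      d-1<d : d - + ℕ.suc o < d
      d-1<d = subst (d - + ℕ.suc o <_) (ℤ.+-identityʳ d) (ℤ.+-monoʳ-< d -<+)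

-- Rigidity on the clique and across heavy edges.

-- A firing function whose maximum is attained on c < a + 1 vertices of the complete
-- graph takes at least a + 1 - c chips from each of them, and c (a + 1 - c) ≥ a.
clique-rigid : ∀ a (D D′ g : Fin (ℕ.suc a) → ℤ) →
               (∀ x → 0ℤ ≤ D x) → (∀ x → 0ℤ ≤ D′ x) →
               (∀ x → D x - D′ x ≡ sum (λ y → g x - g y)) →
               sum D < + a → ∀ x → D x ≡ D′ x
clique-rigid a D D′ g 0≤D 0≤D′ fire small with argmax g
... | x₀ , max = conclude (Fin.all? (λ y → g y ℤ.≟ t))
  where
  t c : ℤ
  t = g x₀

  -- The indicator of the maximizers of `g`, so that `c` counts them.
  b : Fin (ℕ.suc a) → ℤ
  b x = if does (g x ℤ.≟ t) then 1ℤ else 0ℤ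

  c = sum b

  0≤b : ∀ x → 0ℤ ≤ b x
  0≤b x with g x ℤ.≟ t
  ... | yes _ = 0≤+ 1
  ... | no  _ = 0≤+ 0

  1-b≤t-g : ∀ y → 1ℤ - b y ≤ t - g y
  1-b≤t-g y with g y ℤ.≟ t
  ... | yes _    = ℤ.i≤j⇒0≤j-i (max y)
  ... | no  gy≢t = ≤-by _ (ℤ.i≤j⇒0≤j-i (ℤ.i<j⇒suc[i]≤j (ℤ.≤∧≢⇒< (max y) gy≢t))) (lemma t (g y))
    where
    lemma : ∀ u v → u - v - 1ℤ ≡ u - (1ℤ + v)
    lemma = solve-∀

  sum-1-b : sum (λ y → 1ℤ - b y) ≡ + ℕ.suc a - c
  sum-1-b = trans (sum-distrib-- (λ _ → 1ℤ) b)
                  (cong (_- c) (trans (sum-const (ℕ.suc a) 1ℤ) (ℤ.*-identityʳ (+ ℕ.suc a))))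

  -- A maximizer loses at least one chip to each of the `a + 1 - c` other vertices and gains none;
  -- as `D′` is effective, `D` must supply them.
  outdegree≤D : ∀ x → b x * (+ ℕ.suc a - c) ≤ D x
  outdegree≤D x with g x ℤ.≟ t
  ... | no  _    = 0≤D x
  ... | yes gx≡t = begin
    1ℤ * (+ ℕ.suc a - c)         ≡⟨ ℤ.*-identityˡ _ ⟩
    + ℕ.suc a - c                ≡⟨ sum-1-b ⟨
    sum (λ y → 1ℤ - b y)         ≤⟨ sum-mono 1-b≤t-g ⟩
    sum (λ y → t - g y)          ≡⟨ sum-cong-≗ (λ y → cong (_- g y) gx≡t) ⟨
    sum (λ y → g x - g y)        ≡⟨ fire x ⟨
    D x - D′ x                   ≤⟨ ≤-by _ (0≤D′ x) (lemma (D x) (D′ x)) ⟩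
    D x ∎
    where
    open ℤ.≤-Reasoning
    lemma : ∀ u v → u - (u - v) ≡ v
    lemma = solve-∀

  c[n-c]≤sum-D : c * (+ ℕ.suc a - c) ≤ sum D
  c[n-c]≤sum-D = subst (_≤ sum D) (sym (*-distribʳ-sum (+ ℕ.suc a - c) b)) (sum-mono outdegree≤D)

  1≤c : 1ℤ ≤ c
  1≤c = ℤ.≤-trans (ℤ.≤-reflexive (sym bx₀≡1)) (term≤sum 0≤b x₀)
    where
    bx₀≡1 : b x₀ ≡ 1ℤ
    bx₀≡1 with t ℤ.≟ t
    ... | yes _   = refl
    ... | no  t≢t = contradiction refl t≢t

  1≤n-c : ∀ y → g y ≢ t → 1ℤ ≤ + ℕ.suc a - c
  1≤n-c y gy≢t = subst (1ℤ ≤_) sum-1-b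
    (ℤ.≤-trans (ℤ.≤-reflexive (sym 1-by≡1)) (term≤sum 0≤1-b y))
    where
    1-by≡1 : 1ℤ - b y ≡ 1ℤ
    1-by≡1 with g y ℤ.≟ t
    ... | yes gy≡t = contradiction gy≡t gy≢t
    ... | no  _    = refl
    0≤1-b : ∀ x → 0ℤ ≤ 1ℤ - b x
    0≤1-b x with g x ℤ.≟ t
    ... | yes _ = 0≤+ 0
    ... | no  _ = 0≤+ 1

  conclude : Dec (∀ y → g y ≡ t) → ∀ x → D x ≡ D′ x
  conclude (yes const) x = ℤ.i-j≡0⇒i≡j (D x) (D′ x)
    (trans (fire x) (sum-zero (λ y → trans (cong₂ _-_ (const x) (const y)) (ℤ.+-inverseʳ t))))
  conclude (no ¬const) x with Fin.¬∀⟶∃¬ _ _ (λ y → g y ℤ.≟ t) ¬const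
  ... | y , gy≢t = contradiction (ℤ.≤-trans a≤c[n-c] c[n-c]≤sum-D) (ℤ.<⇒≱ small)
    where
    -- The excess of `c (a + 1 - c)` over `a` factors into `c - 1` and `a + 1 - c - 1`, both
    -- nonnegative once some vertex lies below the maximum.
    lemma : ∀ u v → v * (1ℤ + u - v) - u ≡ (v - 1ℤ) * (1ℤ + u - v - 1ℤ)
    lemma = solve-∀
    a≤c[n-c] : + a ≤ c * (+ ℕ.suc a - c)
    a≤c[n-c] = ≤-by _ (nonneg-* (ℤ.i≤j⇒0≤j-i 1≤c) (ℤ.i≤j⇒0≤j-i (1≤n-c y gy≢t))) (lemma (+ a) c)

-- Here `p` and `q` are the chips before and after at one end of a bundle of `1 + M` edges. By
-- integrality a positive `d` would take at least `1 + M` chips from `p`.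
heavy-edge : ∀ M p q d → 0ℤ ≤ q → p < + ℕ.suc M → p - q ≡ + ℕ.suc M * d → d ≤ 0ℤ
heavy-edge M p q d 0≤q p<M eq with d ℤ.≤? 0ℤ
... | yes d≤0 = d≤0
... | no  d≰0 = contradiction M≤p (ℤ.<⇒≱ p<M)
  where
  open ℤ.≤-Reasoning
  M≤p : + ℕ.suc M ≤ p
  M≤p = begin
    + ℕ.suc M       ≡⟨ ℤ.*-identityʳ _ ⟨
    + ℕ.suc M * 1ℤ  ≤⟨ ℤ.*-monoˡ-≤-nonNeg (+ ℕ.suc M) (ℤ.i<j⇒suc[i]≤j (ℤ.≰⇒> d≰0)) ⟩
    + ℕ.suc M * d   ≡⟨ eq ⟨
    p - q           ≤⟨ ℤ.i-j≤i p q {{nonNegative 0≤q}} ⟩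
    p ∎

-- The graph: a clique with pendant vertices.

-- Vertices are those of the complete graph K_{a+1}, followed by k pendant
-- vertices, each joined to vertex 0 of the clique by 1 + M parallel edges.
module CliqueWithPendants (a k M : ℕ) where

  Node : Set
  Node = Fin (ℕ.suc a) ⊎ Fin k

  multiplicity : Node → Node → ℕ
  multiplicity (inj₁ x)       (inj₁ y)       = if does (x Fin.≟ y) then 0 else 1
  multiplicity (inj₁ zero)    (inj₂ _)       = ℕ.suc M
  multiplicity (inj₁ (suc _)) (inj₂ _)       = 0
  multiplicity (inj₂ _)       (inj₁ zero)    = ℕ.suc M
  multiplicity (inj₂ _)       (inj₁ (suc _)) = 0
  multiplicity (inj₂ _)       (inj₂ _)       = 0

  node : Fin (ℕ.suc a ℕ.+ k) → Node
  node = splitAt (ℕ.suc a)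

  multiplicity-comm : ∀ p q → multiplicity p q ≡ multiplicity q p
  multiplicity-comm (inj₁ x) (inj₁ y) with x Fin.≟ y | y Fin.≟ x
  ... | yes _   | yes _   = refl
  ... | no  _   | no  _   = refl
  ... | yes x≡y | no  y≢x = contradiction (sym x≡y) y≢x
  ... | no  x≢y | yes y≡x = contradiction (sym y≡x) x≢y
  multiplicity-comm (inj₁ zero)    (inj₂ _)       = refl
  multiplicity-comm (inj₁ (suc _)) (inj₂ _)       = refl
  multiplicity-comm (inj₂ _)       (inj₁ zero)    = refl
  multiplicity-comm (inj₂ _)       (inj₁ (suc _)) = refl
  multiplicity-comm (inj₂ _)       (inj₂ _)       = refl

  multiplicity-self : ∀ p → multiplicity p p ≡ 0
  multiplicity-self (inj₁ x) with x Fin.≟ x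
  ... | yes _   = refl
  ... | no  x≢x = contradiction refl x≢x
  multiplicity-self (inj₂ _) = refl

  -- Gives connectedness: any two vertices are joined through the root.
  root-or-adjacent : ∀ v → v ≡ zero ⊎ 0 ℕ.< multiplicity (node v) (inj₁ zero)
  root-or-adjacent zero = inj₁ refl
  root-or-adjacent (suc v) with splitAt a v
  ... | inj₁ _ = inj₂ (ℕ.s≤s ℕ.z≤n)
  ... | inj₂ _ = inj₂ (ℕ.s≤s ℕ.z≤n)

  G : Graph
  G = record
    { order      = ℕ.suc a ℕ.+ k
    ; nonempty   = _
    ; ∣E∣        = λ v w → multiplicity (node v) (node w)
    ; undirected = λ v w → multiplicity-comm (node v) (node w)
    ; loopless   = λ v → multiplicity-self (node v)
    ; connected  = λ v w → to-root v ◅◅ from-root w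
    }
    where
    Adj : Fin (ℕ.suc a ℕ.+ k) → Fin (ℕ.suc a ℕ.+ k) → Set
    Adj v w = 0 ℕ.< multiplicity (node v) (node w)
    to-root : ∀ v → Star Adj v zero
    to-root v with root-or-adjacent v
    ... | inj₁ refl = ε
    ... | inj₂ adj  = adj ◅ ε
    from-root : ∀ v → Star Adj zero v
    from-root v with root-or-adjacent v
    ... | inj₁ refl = ε
    ... | inj₂ adj  = subst (0 ℕ.<_) (multiplicity-comm (node v) (inj₁ zero)) adj ◅ ε

  open Graph G using (V; ∣E∣)
  open Firing G

  clique : Fin (ℕ.suc a) → V
  clique x = x ↑ˡ k

  pendant : Fin k → V
  pendant u = ℕ.suc a ↑ʳ u

  root : V
  root = zero

  -- Recovers the two kinds of vertices from the flat numbering that `Graph` demands.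
  V-elim : (P : V → Set) → (∀ x → P (clique x)) → (∀ u → P (pendant u)) → ∀ v → P v
  V-elim P c p v with splitAt (ℕ.suc a) v in eq
  ... | inj₁ x = subst P (Fin.splitAt⁻¹-↑ˡ eq) (c x)
  ... | inj₂ u = subst P (Fin.splitAt⁻¹-↑ʳ eq) (p u)

  node-clique : ∀ x → node (clique x) ≡ inj₁ x
  node-clique x = Fin.splitAt-↑ˡ (ℕ.suc a) x k

  node-pendant : ∀ u → node (pendant u) ≡ inj₂ u
  node-pendant u = Fin.splitAt-↑ʳ (ℕ.suc a) k u

  -- The Laplacian of this graph and its rigidity in low degree.

  -- Passing `p` with an equation lets `multiplicity` compute as soon as `p` is a constructor.
  Δ-node : ∀ f v p → node v ≡ p →
    Δ f v ≡ sum (λ y → + multiplicity p (inj₁ y) * (f v - f (clique y)))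
          + sum (λ u → + multiplicity p (inj₂ u) * (f v - f (pendant u)))
  Δ-node f v p refl = trans (sum-split (ℕ.suc a) (λ w → + ∣E∣ v w * (f v - f w))) (cong₂ _+_
    (sum-cong-≗ (λ y → cong (λ q → + multiplicity p q * (f v - f (clique y))) (node-clique y)))
    (sum-cong-≗ (λ u → cong (λ q → + multiplicity p q * (f v - f (pendant u))) (node-pendant u))))

  Δ-pendant : ∀ f u → Δ f (pendant u) ≡ + ℕ.suc M * (f (pendant u) - f root)
  Δ-pendant f u = begin
    Δ f (pendant u)
      ≡⟨ Δ-node f (pendant u) (inj₂ u) (node-pendant u) ⟩
    + ℕ.suc M * d + sum (λ y → 0ℤ * (f (pendant u) - f (clique (suc y))))
                      + sum (λ w → 0ℤ * (f (pendant u) - f (pendant w)))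
      ≡⟨ cong₂ (λ p q → + ℕ.suc M * d + p + q) (sum-zero (λ y → ℤ.*-zeroˡ (f (pendant u) - f (clique (suc y)))))
          (sum-zero (λ w → ℤ.*-zeroˡ (f (pendant u) - f (pendant w)))) ⟩
    + ℕ.suc M * d + 0ℤ + 0ℤ
      ≡⟨ trans (ℤ.+-identityʳ _) (ℤ.+-identityʳ _) ⟩
    + ℕ.suc M * d ∎
    where
    open ≡-Reasoning
    d : ℤ
    d = f (pendant u) - f root

  -- With nothing crossing the heavy edges only clique edges count. The absent loop at `x` may be
  -- counted as an edge because its difference is zero.
  Δ-clique : ∀ f → (∀ u → f (pendant u) ≡ f root) → ∀ x →
             Δ f (clique x) ≡ sum (λ y → f (clique x) - f (clique y))
  Δ-clique f const x = begin
    Δ f (clique x)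
      ≡⟨ Δ-node f (clique x) (inj₁ x) (node-clique x) ⟩
    _ ≡⟨ cong₂ _+_ (sum-cong-≗ light) (sum-zero (λ u → heavy x u)) ⟩
    sum (λ y → f (clique x) - f (clique y)) + 0ℤ
      ≡⟨ ℤ.+-identityʳ _ ⟩
    sum (λ y → f (clique x) - f (clique y)) ∎
    where
    open ≡-Reasoning
    light : ∀ y → + multiplicity (inj₁ x) (inj₁ y) * (f (clique x) - f (clique y))
                ≡ f (clique x) - f (clique y)
    light y with x Fin.≟ y
    ... | yes refl = trans (ℤ.*-zeroˡ (f (clique x) - f (clique x))) (sym (ℤ.+-inverseʳ (f (clique x))))
    ... | no  _    = ℤ.*-identityˡ _
    heavy : ∀ x u → + multiplicity (inj₁ x) (inj₂ u) * (f (clique x) - f (pendant u)) ≡ 0ℤ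
    heavy zero    u = trans (cong (_*_ (+ ℕ.suc M)) (trans (cong (_-_ (f root)) (const u)) (ℤ.+-inverseʳ (f root))))
                            (ℤ.*-zeroʳ (+ ℕ.suc M))
    heavy (suc y) u = ℤ.*-zeroˡ (f (clique (suc y)) - f (pendant u))

  deg-split : ∀ D → deg G D ≡ sum (λ x → D (clique x)) + sum (λ u → D (pendant u))
  deg-split D = sum-split (ℕ.suc a) D

  -- `heavy-edge` is used in both directions: chips leaving a pendant would need `1 + M` of them in
  -- `D`, chips arriving would leave `1 + M` of them in `D′`, which has the same degree.
  rigid : ∀ D D′ f → Effective G D → Effective G D′ → deg G D < + ℕ.suc M →
          D ∼[ f ] D′ → ∀ u → f (pendant u) ≡ f root
  rigid D D′ f 0≤D 0≤D′ small eq u =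
    ℤ.i-j≡0⇒i≡j (f (pendant u)) (f root) (ℤ.≤-antisym d≤0 0≤d)
    where
    M′ d p q : ℤ
    M′ = + ℕ.suc M
    d = f (pendant u) - f root
    p = D (pendant u)
    q = D′ (pendant u)
    p-q : p - q ≡ M′ * d
    p-q = trans (eq (pendant u)) (Δ-pendant f u)
    d≤0 : d ≤ 0ℤ
    d≤0 = heavy-edge M p q d (0≤D′ _) (ℤ.≤-<-trans (term≤sum 0≤D (pendant u)) small) p-q
    swap : ∀ p q → q - p ≡ - (p - q)
    swap = solve-∀
    0≤d : 0ℤ ≤ d
    0≤d = ℤ.neg-cancel-≤ (heavy-edge M q p (- d) (0≤D _)
      (ℤ.≤-<-trans (term≤sum 0≤D′ (pendant u)) (subst (_< M′) (deg-∼[] D D′ f eq) small))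
      (trans (swap p q) (trans (cong -_ p-q) (ℤ.neg-distribʳ-* M′ d))))

  rigid-pendant : ∀ D D′ f → Effective G D → Effective G D′ → deg G D < + ℕ.suc M →
                  D ∼[ f ] D′ → ∀ u → D (pendant u) ≡ D′ (pendant u)
  rigid-pendant D D′ f 0≤D 0≤D′ small eq u = ℤ.i-j≡0⇒i≡j _ _ (begin
    D (pendant u) - D′ (pendant u)           ≡⟨ eq (pendant u) ⟩
    Δ f (pendant u)                          ≡⟨ Δ-pendant f u ⟩
    + ℕ.suc M * (f (pendant u) - f root)     ≡⟨ cong (λ t → + ℕ.suc M * (t - f root))
                                                     (rigid D D′ f 0≤D 0≤D′ small eq u) ⟩
    + ℕ.suc M * (f root - f root)            ≡⟨ cong (_*_ (+ ℕ.suc M)) (ℤ.+-inverseʳ (f root)) ⟩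
    + ℕ.suc M * 0ℤ                           ≡⟨ ℤ.*-zeroʳ (+ ℕ.suc M) ⟩
    0ℤ ∎)
    where open ≡-Reasoning

  rigid-clique : ∀ D D′ f → Effective G D → Effective G D′ → deg G D < + ℕ.suc M →
                 D ∼[ f ] D′ → sum (λ x → D (clique x)) < + a →
                 ∀ x → D (clique x) ≡ D′ (clique x)
  rigid-clique D D′ f 0≤D 0≤D′ small eq few = clique-rigid a _ _ (λ x → f (clique x))
    (λ x → 0≤D _) (λ x → 0≤D′ _)
    (λ x → trans (eq (clique x)) (Δ-clique f (rigid D D′ f 0≤D 0≤D′ small eq) x)) few

  -- Lower bounds on the degree.

  -- Rigidity needs effective divisors on both sides, and `D ⊖ E` need not be one. Moving `E` across
  -- and subtracting the firing functions relates `D₁` to a divisor that dominates `E`.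
  compare : ∀ D D₁ r → RemainsEffective G D r → Defs._∼_ G D D₁ →
            ∀ E → Effective G E → deg G E ≡ + r →
            Σ[ F ∈ Divisor G ] Effective G F × Σ[ f ∈ (V → ℤ) ] D₁ ∼[ f ] F ⊕ E
  compare D D₁ r re s E 0≤E degE = let F , 0≤F , t = re E 0≤E degE in
    F , 0≤F , (λ v → proj₁ t v - proj₁ s v) , λ v → begin
    D₁ v - (F v + E v)                 ≡⟨ lemma (D v) (D₁ v) (E v) (F v) ⟩
    D v - E v - F v - (D v - D₁ v)     ≡⟨ cong₂ _-_ (∼⇒∼[] (D ⊝ E) F t v) (∼⇒∼[] D D₁ s v) ⟩
    Δ (proj₁ t) v - Δ (proj₁ s) v      ≡⟨ Δ-distrib-- (proj₁ t) (proj₁ s) v ⟨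
    Δ (λ w → proj₁ t w - proj₁ s w) v  ∎
    where
    open ≡-Reasoning
    lemma : ∀ d d₁ e f → d₁ - (f + e) ≡ d - e - f - (d - d₁)
    lemma = solve-∀

  pendant-lower : ∀ D D₁ r → RemainsEffective G D r → Effective G D₁ → Defs._∼_ G D D₁ →
                  deg G D₁ < + ℕ.suc M → ∀ u → + r ≤ D₁ (pendant u)
  pendant-lower D D₁ r re 0≤D₁ s small u =
    let F , 0≤F , f , eq = compare D D₁ r re s (r · pendant u) (·-effective r (pendant u)) (deg-· r (pendant u))
    in begin
    + r                                          ≡⟨ ·-at r (pendant u) ⟨
    (r · pendant u) (pendant u)                  ≤⟨ ≤+ˡ (0≤F _) ℤ.≤-refl ⟩
    F (pendant u) + (r · pendant u) (pendant u)  ≡⟨ rigid-pendant D₁ (F ⊕ r · pendant u) f 0≤D₁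
                                                      (⊕-effective 0≤F (·-effective r (pendant u))) small eq u ⟨
    D₁ (pendant u) ∎
    where open ℤ.≤-Reasoning

  clique-lower : ∀ D D₁ → RemainsEffective G D 1 → Effective G D₁ → Defs._∼_ G D D₁ →
                 deg G D₁ < + ℕ.suc M → + a ≤ sum (λ x → D₁ (clique x))
  clique-lower D D₁ re 0≤D₁ s small with + a ℤ.≤? sum (λ x → D₁ (clique x))
  ... | yes a≤sum = a≤sum
  -- With fewer than `a` chips on the clique, rigidity lets each test chip `1 · clique x` be read
  -- off in `D₁` itself, which forces even `a + 1` chips.
  ... | no  a≰sum = begin
    + a                          ≤⟨ ℤ.i≤suc[i] (+ a) ⟩
    + ℕ.suc a                    ≡⟨ ℤ.*-identityʳ _ ⟨
    + ℕ.suc a * 1ℤ               ≡⟨ sum-const (ℕ.suc a) 1ℤ ⟨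
    sum {ℕ.suc a} (λ _ → 1ℤ)     ≤⟨ sum-mono 1≤D₁ ⟩
    sum (λ x → D₁ (clique x)) ∎
    where
    open ℤ.≤-Reasoning
    1≤D₁ : ∀ x → 1ℤ ≤ D₁ (clique x)
    1≤D₁ x =
      let F , 0≤F , f , eq = compare D D₁ 1 re s (1 · clique x) (·-effective 1 (clique x)) (deg-· 1 (clique x))
      in begin
      1ℤ                                        ≡⟨ ·-at 1 (clique x) ⟨
      (1 · clique x) (clique x)                 ≤⟨ ≤+ˡ (0≤F _) ℤ.≤-refl ⟩
      F (clique x) + (1 · clique x) (clique x)  ≡⟨ rigid-clique D₁ (F ⊕ 1 · clique x) f 0≤D₁
                                                    (⊕-effective 0≤F (·-effective 1 (clique x))) small eq
                                                    (ℤ.≰⇒> a≰sum) x ⟨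
      D₁ (clique x) ∎

  -- The degree forced by rank `j + 1`: `j` chips removed beforehand, `a` on the clique, `j + 1` on
  -- each pendant. The values 0 and 1 of `j` give the two gonalities.
  bound : ℕ → ℤ
  bound j = + j + (+ a + + k * + ℕ.suc j)

  -- One representative `D₁` of `D` less `j` chips at the root yields both counts: the clique uses
  -- the remaining rank one, the pendants the full rank of `D`.
  deg-lower : ∀ j D → RemainsEffective G D (ℕ.suc j) → deg G D < + ℕ.suc M → bound j ≤ deg G D
  deg-lower j D re small = from-equivalent (remainsEffective⇒equivalentToEffective D′ 1 root re′)
    where
    D′ : Divisor G
    D′ = D ⊝ j · root
    re′ : RemainsEffective G D′ 1
    re′ = remainsEffective-⊖ D j root re
    from-equivalent : EquivalentToEffective G D′ → bound j ≤ deg G D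
    from-equivalent (D₁ , 0≤D₁ , s) = begin
      + j + (+ a + + k * + ℕ.suc j)
        ≡⟨ cong (λ t → + j + (+ a + t)) (sum-const k (+ ℕ.suc j)) ⟨
      + j + (+ a + sum {k} (λ _ → + ℕ.suc j))
        ≤⟨ ℤ.+-monoʳ-≤ (+ j) (ℤ.+-mono-≤ (clique-lower D′ D₁ re′ 0≤D₁ s D₁-small) (sum-mono j<D₁)) ⟩
      + j + (sum (λ x → D₁ (clique x)) + sum (λ u → D₁ (pendant u)))
        ≡⟨ cong (_+_ (+ j)) (trans (sym (deg-split D₁)) degD₁) ⟩
      + j + (deg G D - + j)
        ≡⟨ lemma (+ j) (deg G D) ⟩
      deg G D ∎
      where
      open ℤ.≤-Reasoning
      lemma : ∀ u v → u + (v - u) ≡ v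
      lemma = solve-∀
      degD₁ : deg G D₁ ≡ deg G D - + j
      degD₁ = trans (sym (deg-∼[] D′ D₁ (proj₁ s) (∼⇒∼[] D′ D₁ s))) (deg-⊖-· D j root)
      D₁-small : deg G D₁ < + ℕ.suc M
      D₁-small = ℤ.≤-<-trans (subst (_≤ deg G D) (sym degD₁) (ℤ.i-j≤i (deg G D) (+ j))) small
      -- Returning the `j` chips to the root gives a divisor equivalent to `D` with the same pendant
      -- values as `D₁`.
      A : Divisor G
      A = D₁ ⊕ j · root
      D∼A : Defs._∼_ G D A
      D∼A = ∼[]⇒∼ D A (proj₁ s) (λ v →
        trans (shift (D v) (D₁ v) ((j · root) v)) (∼⇒∼[] D′ D₁ s v))
        where
        shift : ∀ d d₁ e → d - (d₁ + e) ≡ d - e - d₁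
        shift = solve-∀
      A-small : deg G A < + ℕ.suc M
      A-small = subst (_< + ℕ.suc M) (deg-∼[] D A (proj₁ D∼A) (∼⇒∼[] D A D∼A)) small
      j<D₁ : ∀ u → + ℕ.suc j ≤ D₁ (pendant u)
      j<D₁ u = ℤ.≤-trans
        (pendant-lower D A (ℕ.suc j) re (⊕-effective 0≤D₁ (·-effective j root)) D∼A A-small u)
        (ℤ.≤-reflexive (trans (cong (_+_ (D₁ (pendant u))) (ℤ.*-zeroˡ (+ j))) (ℤ.+-identityʳ _)))

  -- Rigidity settles degrees below `1 + M`; beyond that the hypothesis on `bound j` suffices.
  gonality-lower : ∀ j → bound j ≤ + ℕ.suc M → ∀ D → RemainsEffective G D (ℕ.suc j) → bound j ≤ deg G D
  gonality-lower j bound≤M D re with deg G D ℤ.<? + ℕ.suc M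
  ... | yes small = deg-lower j D re small
  ... | no  large = ℤ.≤-trans bound≤M (ℤ.≮⇒≥ large)

  -- Divisors attaining the bounds.

  -- Every vertex whose nearest clique vertex is not x fires once.
  borrow : ∀ D x → (∀ u → 0ℤ ≤ D (pendant u)) → (∀ y → x ≢ y → 1ℤ ≤ D (clique y)) →
           0ℤ ≤ D (clique x) + + a → EquivalentToEffective G D
  borrow D x 0≤pendants 1≤others 0≤D+a = D′ ,
    V-elim (λ v → 0ℤ ≤ D′ v) D′-clique D′-pendant ,
    ∼[]⇒∼ D D′ f (λ v → sub-sub (D v) (Δ f v))
    where
    -- The same firing shifted by the constant -1, which leaves `Δ` unchanged: `x` fires -1 times
    -- and all other clique vertices 0 times. Pendants copy the root, so heavy edges stay idle.
    f : V → ℤ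
    f v = - [ δ x , (λ _ → δ x zero) ]′ (node v)

    D′ : Divisor G
    D′ v = D v - Δ f v

    sub-sub : ∀ d e → d - (d - e) ≡ e
    sub-sub = solve-∀

    f-clique : ∀ y → f (clique y) ≡ - δ x y
    f-clique y = cong (λ p → - [ δ x , (λ _ → δ x zero) ]′ p) (node-clique y)

    f-pendant : ∀ u → f (pendant u) ≡ f root
    f-pendant u = cong (λ p → - [ δ x , (λ _ → δ x zero) ]′ p) (node-pendant u)

    Δf-pendant : ∀ u → Δ f (pendant u) ≡ 0ℤ
    Δf-pendant u = begin
      Δ f (pendant u)                       ≡⟨ Δ-pendant f u ⟩
      + ℕ.suc M * (f (pendant u) - f root)  ≡⟨ cong (λ t → + ℕ.suc M * (t - f root)) (f-pendant u) ⟩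
      + ℕ.suc M * (f root - f root)         ≡⟨ cong (_*_ (+ ℕ.suc M)) (ℤ.+-inverseʳ (f root)) ⟩
      + ℕ.suc M * 0ℤ                        ≡⟨ ℤ.*-zeroʳ (+ ℕ.suc M) ⟩
      0ℤ ∎
      where open ≡-Reasoning

    -- A loss of one chip away from `x` and a gain of `a` chips at `x`.
    Δf-clique : ∀ y → Δ f (clique y) ≡ 1ℤ - + ℕ.suc a * δ x y
    Δf-clique y = begin
      Δ f (clique y)
        ≡⟨ Δ-clique f f-pendant y ⟩
      sum (λ z → f (clique y) - f (clique z))
        ≡⟨ sum-cong-≗ (λ z → trans (cong₂ _-_ (f-clique y) (f-clique z)) (lemma (δ x y) (δ x z))) ⟩
      sum (λ z → δ x z * 1ℤ - δ x y)
        ≡⟨ sum-distrib-- (λ z → δ x z * 1ℤ) (λ _ → δ x y) ⟩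
      sum (λ z → δ x z * 1ℤ) - sum {ℕ.suc a} (λ _ → δ x y)
        ≡⟨ cong₂ _-_ (sum-δ x (λ _ → 1ℤ)) (sum-const (ℕ.suc a) (δ x y)) ⟩
      1ℤ - + ℕ.suc a * δ x y ∎
      where
      open ≡-Reasoning
      lemma : ∀ d e → - d - - e ≡ e * 1ℤ - d
      lemma = solve-∀

    D′-pendant : ∀ u → 0ℤ ≤ D′ (pendant u)
    D′-pendant u = subst (0ℤ ≤_)
      (sym (trans (cong (_-_ (D (pendant u))) (Δf-pendant u)) (ℤ.+-identityʳ _))) (0≤pendants u)

    D′-clique : ∀ y → 0ℤ ≤ D′ (clique y)
    D′-clique y = subst (λ t → 0ℤ ≤ D (clique y) - t) (sym (Δf-clique y)) (gain y)
      where
      gain : ∀ y → 0ℤ ≤ D (clique y) - (1ℤ - + ℕ.suc a * δ x y)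
      gain y with x Fin.≟ y
      ... | yes refl = subst (0ℤ ≤_) (lemma (D (clique x)) (+ a)) 0≤D+a
        where
        lemma : ∀ d n → d + n ≡ d - (1ℤ - (1ℤ + n) * 1ℤ)
        lemma = solve-∀
      ... | no x≢y = subst (0ℤ ≤_) (lemma (D (clique y)) (+ a)) (ℤ.i≤j⇒0≤j-i (1≤others y x≢y))
        where
        lemma : ∀ d n → d - 1ℤ ≡ d - (1ℤ - (1ℤ + n) * 0ℤ)
        lemma = solve-∀

  effective≤deg : ∀ {E r} → Effective G E → deg G E ≡ + r → ∀ v → E v ≤ + r
  effective≤deg {E} 0≤E degE v = subst (E v ≤_) degE (term≤sum 0≤E v)

  -- The `r` chips on `clique x` already exhaust the degree of `E`.
  others-zero : ∀ {E r} → Effective G E → deg G E ≡ + r → ∀ {x} → + r ≤ E (clique x) →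
                ∀ y → x ≢ y → E (clique y) ≤ 0ℤ
  others-zero {E} {r} 0≤E degE {x} r≤Ex y x≢y = +-cancelˡ-≤ (+ r) (begin
    + r + E (clique y)           ≤⟨ ℤ.+-monoˡ-≤ (E (clique y)) r≤Ex ⟩
    E (clique x) + E (clique y)  ≤⟨ two-terms≤sum 0≤E (clique x) (clique y) (x≢y ∘ Fin.↑ˡ-injective k x y) ⟩
    deg G E                      ≡⟨ degE ⟩
    + r                          ≡⟨ ℤ.+-identityʳ _ ⟨
    + r + 0ℤ ∎)
    where open ℤ.≤-Reasoning

  fromNodes : (Fin (ℕ.suc a) → ℤ) → ℤ → Divisor G
  fromNodes c p v = [ c , (λ _ → p) ]′ (node v)

  fromNodes-clique : ∀ c p x → fromNodes c p (clique x) ≡ c x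
  fromNodes-clique c p x = cong [ c , (λ _ → p) ]′ (node-clique x)

  fromNodes-pendant : ∀ c p u → fromNodes c p (pendant u) ≡ p
  fromNodes-pendant c p u = cong [ c , (λ _ → p) ]′ (node-pendant u)

  deg-fromNodes : ∀ c p → deg G (fromNodes c p) ≡ sum c + + k * p
  deg-fromNodes c p = trans (deg-split (fromNodes c p)) (cong₂ _+_
    (sum-cong-≗ (fromNodes-clique c p))
    (trans (sum-cong-≗ (fromNodes-pendant c p)) (sum-const k p)))

  i≤j⇒0≤j′-i : ∀ {i j j′} → j′ ≡ j → i ≤ j → 0ℤ ≤ j′ - i
  i≤j⇒0≤j′-i refl i≤j = ℤ.i≤j⇒0≤j-i i≤j

  1≤j′-i : ∀ {i j j′} → j′ ≡ j → 1ℤ ≤ j → i ≤ 0ℤ → 1ℤ ≤ j′ - i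
  1≤j′-i refl 1≤j i≤0 = ℤ.+-mono-≤ 1≤j (ℤ.neg-mono-≤ i≤0)

  -- The root may start empty, since a chip demanded there can be borrowed from the rest of the
  -- clique.
  allButRoot : Fin (ℕ.suc a) → ℤ
  allButRoot zero    = 0ℤ
  allButRoot (suc _) = 1ℤ

  W₁ W₂ : Divisor G
  W₁ = fromNodes allButRoot 1ℤ
  W₂ = fromNodes (λ _ → 1ℤ) (+ 2)

  deg-W₁ : deg G W₁ ≡ bound 0
  deg-W₁ = begin
    deg G W₁                              ≡⟨ deg-fromNodes allButRoot 1ℤ ⟩
    0ℤ + sum {a} (λ _ → 1ℤ) + + k * 1ℤ    ≡⟨ cong (λ t → 0ℤ + t + + k * 1ℤ) (sum-const a 1ℤ) ⟩
    0ℤ + + a * 1ℤ + + k * 1ℤ              ≡⟨ lemma (+ a) (+ k) ⟩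
    0ℤ + (+ a + + k * 1ℤ) ∎
    where
    open ≡-Reasoning
    lemma : ∀ a k → 0ℤ + a * 1ℤ + k * 1ℤ ≡ 0ℤ + (a + k * 1ℤ)
    lemma = solve-∀

  deg-W₂ : deg G W₂ ≡ bound 1
  deg-W₂ = begin
    deg G W₂                              ≡⟨ deg-fromNodes (λ _ → 1ℤ) (+ 2) ⟩
    sum {ℕ.suc a} (λ _ → 1ℤ) + + k * + 2  ≡⟨ cong (_+ + k * + 2) (sum-const (ℕ.suc a) 1ℤ) ⟩
    (1ℤ + + a) * 1ℤ + + k * + 2           ≡⟨ lemma (+ a) (+ k * + 2) ⟩
    1ℤ + (+ a + + k * + 2) ∎
    where
    open ≡-Reasoning
    lemma : ∀ a t → (1ℤ + a) * 1ℤ + t ≡ 1ℤ + (a + t)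
    lemma = solve-∀

  W₁-remainsEffective : 1 ℕ.≤ a → RemainsEffective G W₁ 1
  W₁-remainsEffective 1≤a E 0≤E degE with E root ℤ.≤? 0ℤ
  ... | yes E≤0 = effective⇒equivalentToEffective {W₁ ⊝ E} (V-elim (λ v → 0ℤ ≤ (W₁ ⊝ E) v)
    (λ { zero    → ℤ.i≤j⇒0≤j-i E≤0
       ; (suc y) → i≤j⇒0≤j′-i (fromNodes-clique allButRoot 1ℤ (suc y)) (effective≤deg 0≤E degE _) })
    (λ u → i≤j⇒0≤j′-i (fromNodes-pendant allButRoot 1ℤ u) (effective≤deg 0≤E degE _)))
  ... | no E≰0 = borrow (W₁ ⊝ E) zero
    (λ u → i≤j⇒0≤j′-i (fromNodes-pendant allButRoot 1ℤ u) (effective≤deg 0≤E degE _))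
    (λ { zero    0≢0 → contradiction refl 0≢0
       ; (suc y) 0≢y → 1≤j′-i (fromNodes-clique allButRoot 1ℤ (suc y)) ℤ.≤-refl
           (others-zero 0≤E degE {zero} (ℤ.i<j⇒suc[i]≤j (ℤ.≰⇒> E≰0)) (suc y) 0≢y) })
    -- The debt at the root is at most 1, and borrowing brings in `a` chips.
    (≤-by _ (ℤ.i≤j⇒0≤j-i (ℤ.≤-trans (effective≤deg 0≤E degE root) (+≤+ 1≤a))) (lemma (E root) (+ a)))
    where
    lemma : ∀ e n → 0ℤ - e + n - 0ℤ ≡ n - e
    lemma = solve-∀

  W₂-remainsEffective : 1 ℕ.≤ a → RemainsEffective G W₂ 2
  W₂-remainsEffective 1≤a E 0≤E degE = decide (Fin.all? (λ x → E (clique x) ℤ.≤? 1ℤ))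
    where
    pendants : ∀ u → 0ℤ ≤ W₂ (pendant u) - E (pendant u)
    pendants u = i≤j⇒0≤j′-i (fromNodes-pendant (λ _ → 1ℤ) (+ 2) u) (effective≤deg 0≤E degE _)
    decide : Dec (∀ x → E (clique x) ≤ 1ℤ) → EquivalentToEffective G (W₂ ⊝ E)
    decide (yes E≤1) = effective⇒equivalentToEffective {W₂ ⊝ E} (V-elim (λ v → 0ℤ ≤ (W₂ ⊝ E) v)
      (λ x → i≤j⇒0≤j′-i (fromNodes-clique (λ _ → 1ℤ) (+ 2) x) (E≤1 x)) pendants)
    -- A clique vertex asked for more than one chip carries all of `E`. Its debt is then at most 1,
    -- and the other clique vertices still have a chip to lend.
    decide (no E≰1) with Fin.¬∀⟶∃¬ _ _ (λ x → E (clique x) ℤ.≤? 1ℤ) E≰1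
    ... | x , Ex≰1 = borrow (W₂ ⊝ E) x pendants
      (λ y x≢y → 1≤j′-i (fromNodes-clique (λ _ → 1ℤ) (+ 2) y) ℤ.≤-refl
        (others-zero 0≤E degE (ℤ.i<j⇒suc[i]≤j (ℤ.≰⇒> Ex≰1)) y x≢y))
      (subst (λ w → 0ℤ ≤ w - E (clique x) + + a) (sym (fromNodes-clique (λ _ → 1ℤ) (+ 2) x))
        (≤-by _ (ℤ.i≤j⇒0≤j-i (ℤ.≤-trans (effective≤deg 0≤E degE (clique x)) (ℤ.+-monoʳ-≤ 1ℤ (+≤+ 1≤a))))
          (lemma (E (clique x)) (+ a))))
      where
      lemma : ∀ e n → 1ℤ - e + n - 0ℤ ≡ 1ℤ + n - e
      lemma = solve-∀

  gonality₁ : 1 ℕ.≤ a → bound 0 ≤ + ℕ.suc M → IsGonality G (+ 1) (bound 0)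
  gonality₁ 1≤a small = isGonality root W₁ (W₁-remainsEffective 1≤a) deg-W₁
                                   (gonality-lower 0 small) (ℕ.s≤s ℕ.z≤n)

  gonality₂ : 1 ℕ.≤ a → bound 1 ≤ + ℕ.suc M → IsGonality G (+ 2) (bound 1)
  gonality₂ 1≤a small = isGonality root W₂ (W₂-remainsEffective 1≤a) deg-W₂
                                   (gonality-lower 1 small) (ℕ.s≤s ℕ.z≤n)

-- Choice of parameters.

-- The witnesses are `k = n - m - 1` and `a = 2m - n`; after cancelling `m`, the upper bound on `n`
-- says that `k + 1` is at most `m`. The clique parameter will be `suc a`, hence positive.
parametrization : ∀ m n → m ℕ.< n → n ℕ.≤ 2 ℕ.* m →
                  ∃[ a ] ∃[ k ] m ≡ ℕ.suc a ℕ.+ k × n ≡ ℕ.suc (ℕ.suc a ℕ.+ k ℕ.* 2)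
parametrization m _ m<n n≤2m with ℕ.m≤n⇒∃[o]m+o≡n m<n
... | k , refl with ℕ.m≤n⇒∃[o]m+o≡n (ℕ.+-cancelˡ-≤ m (ℕ.suc k) m
                     (subst₂ ℕ._≤_ (sym (ℕ.+-suc m k)) (cong (ℕ._+_ m) (ℕ.+-identityʳ m)) n≤2m))
...   | a , refl = a , k , cong ℕ.suc (ℕ.+-comm k a) , cong (ℕ.suc ∘ ℕ.suc) (lemma a k)
  where
  lemma : ∀ a k → k ℕ.+ a ℕ.+ k ≡ a ℕ.+ k ℕ.* 2
  lemma = ℕ-solve-∀

theorem1p5 : ∀ (m n : ℤ) → + 1 ≤ m → m < n → n ≤ + 2 * m →
    Σ[ G ∈ Graph ] (IsGonality G (+ 1) m × IsGonality G (+ 2) n)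
theorem1p5 (+ m) (+ n) _ (+<+ m<n) n≤2m
  with parametrization m n m<n (ℤ.drop‿+≤+ (subst (+ n ≤_) (sym (ℤ.pos-* 2 m)) n≤2m))
... | a , k , refl , refl =
  G , subst (IsGonality G (+ 1)) bound₀ (gonality₁ (ℕ.s≤s ℕ.z≤n) bound₀≤M) ,
      subst (IsGonality G (+ 2)) bound₁ (gonality₂ (ℕ.s≤s ℕ.z≤n) (ℤ.≤-reflexive bound₁))
  where
  -- Here `M` is `n - 1`, so the heavy bundles have `n` edges and `bound 1` exactly meets the
  -- threshold `1 + M`.
  open CliqueWithPendants (ℕ.suc a) k (ℕ.suc a ℕ.+ k ℕ.* 2)
  bound₀ : bound 0 ≡ + (ℕ.suc a ℕ.+ k)
  bound₀ = trans (ℤ.+-identityˡ _) (cong (λ t → + ℕ.suc a + t) (ℤ.*-identityʳ (+ k)))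
  bound₁ : bound 1 ≡ + ℕ.suc (ℕ.suc a ℕ.+ k ℕ.* 2)
  bound₁ = cong (λ t → 1ℤ + (+ ℕ.suc a + t)) (sym (ℤ.pos-* k 2))
  bound₀≤M : bound 0 ≤ + ℕ.suc (ℕ.suc a ℕ.+ k ℕ.* 2)
  bound₀≤M = subst (_≤ + ℕ.suc (ℕ.suc a ℕ.+ k ℕ.* 2)) (sym bound₀) (ℤ.<⇒≤ (+<+ m<n))
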